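{- For any labeled poset $(P,\omega)$ with $|P|\ge2$, $$\Omega(P,\omega;t)=\Delta^{ -1}\sum_{\emptyset\ne S\in\mathcal I_\omega(P)}\Omega(P\setminus S,\omega;t).$$
   Context: All posets are finite and $\mathbb N^+=\{1,2,\dots\}$, $[n]=\{1,\dots,n\}$. An ideal of a poset $P$ is a down-closed subset (including $\emptyset$ and $P$). A labeled poset $(P,\omega)$ is a finite poset $P$ with an injective map $\omega:P\to\mathbb N^+$; each subset $S\subseteq P$ carries the induced order and labeling, giving a labeled poset $(S,\omega)$. A subset $S$ is $\omega$-natural if $\omega|_S$ is order-preserving; $\mathcal I_\omega(P)$ is the set of ideals of $P$ that are $\omega$-natural. A map $f:P\to[n]$ is $\omega$-order-preserving if it is order-preserving and $f(x)>f(y)$ whenever $x>y$ in $P$ and $\omega(x)<\omega(y)$. The order polynomial $\Omega(P,\omega;t)$ is the unique polynomial in $t$ whose value at each $n\in\mathbb N^+$ is the number of $\omega$-order-preserving maps $P\to[n]$; $\Omega(\emptyset,\omega;t)=1$. The operator $\Delta$ on $\mathbb C[t]$ is $(\Delta f)(t)=f(t+1)-f(t)$, and $\Delta^{ -1}:\mathbb C[t]\to\mathbb C[t]$ is the linear operator sending $f$ to the unique polynomial $g$ with $g(0)=0$ and $\Delta g=f$. -}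

module Defs where

open import Level using (Level; 0ℓ)
open import Algebra.Apartness.Bundles using (HeytingField; HeytingCommutativeRing)
open import Algebra.Bundles using (CommutativeRing)
import Algebra.Properties.Group as GroupProperties
import Algebra.Properties.Ring as RingProperties
import Algebra.Properties.Semiring.Mult as Multiples
import Algebra.Solver.Ring.NaturalCoefficients.Default as RingSolver
open import Data.Bool.Base using (Bool; true; false)
import Data.Bool.Properties as Bool
open import Data.Empty using (⊥-elim)
open import Data.Fin.Base as Fin using (Fin; zero; suc)
import Data.Fin.Properties as Fin
open import Data.Fin.Subset
  using (Subset; inside; outside; _∈_; _⊆_; Nonempty; ∣_∣; ∁; ⁅_⁆; _∪_; ⊤; ⊥)
open import Data.Fin.Subset.Properties
  using (_∈?_; nonempty?; drop-there; x∈⁅x⁆; x∈⁅y⁆⇒x≡y; x∈p∪q⁺; x∈p∪q⁻; ∉⊥; ∈⊤; ⊆-antisym; ⊆-max)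
open import Data.List.Base as List
  using (List; []; _∷_; _++_; map; filter; length; foldr; allFin; cartesianProductWith)
import Data.List.Properties as List
open import Data.List.Membership.Propositional using () renaming (_∈_ to _∈ₗ_)
open import Data.List.Membership.Propositional.Properties
  using (∈-allFin; ∈-cartesianProductWith⁺; ∈-filter⁺; ∈-filter⁻; ∈-map⁺; ∈-map⁻)
open import Data.List.Relation.Unary.All as All using (All; []; _∷_)
open import Data.List.Relation.Unary.AllPairs using ([]; _∷_)
open import Data.List.Relation.Unary.Any as Any using (here; there)
open import Data.List.Relation.Unary.Unique.Propositional using (Unique)
import Data.List.Relation.Unary.Unique.Propositional.Properties as Unique
open import Data.Nat.Base as ℕ using (ℕ; zero; suc; z≤n; s≤s)
open import Data.Nat.ListAction using (sum)
open import Data.Nat.ListAction.Properties using (sum-++)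
import Data.Nat.Properties as ℕ
open import Data.Product using (∃; ∃!; _×_; _,_; proj₁; proj₂)
open import Data.Sum.Base using (inj₁; inj₂)
open import Data.Vec.Base as Vec using (Vec; []; _∷_; lookup; here; there)
import Data.Vec.Properties as Vec
open import Function.Base using (_∘_; id)
open import Function.Definitions using (Injective)
open import Relation.Binary.Core using (Rel)
open import Relation.Binary.Definitions using (DecidableEquality)
open import Relation.Binary.Structures using (IsDecPartialOrder)
import Relation.Binary.Reasoning.Setoid as ≈-Reasoning
import Relation.Binary.Construct.NonStrictToStrict as NonStrictToStrict
open import Relation.Binary.PropositionalEquality as ≡
  using (_≡_; _≢_; refl; cong; cong₂; subst; module ≡-Reasoning)
open import Relation.Nullary using (¬_; Dec; yes; no)
open import Relation.Nullary.Decidable using (_×-dec_; _→-dec_; map′)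
open import Relation.Unary using (Pred; Decidable)

-- All vectors with entries from a given list.  Subsets of Fin m are
-- boolean vectors, and a map Fin m → Fin n, i.e. to [n], is represented
-- by the vector of its values, so this enumerates both.

allVecs : ∀ {a} {A : Set a} → List A → ∀ m → List (Vec A m)
allVecs xs zero    = [] ∷ []
allVecs xs (suc m) = cartesianProductWith _∷_ xs (allVecs xs m)

∈-allVecs : ∀ {a} {A : Set a} {xs : List A} → (∀ x → x ∈ₗ xs) →
            ∀ {m} (v : Vec A m) → v ∈ₗ allVecs xs m
∈-allVecs all []      = here refl
∈-allVecs all (x ∷ v) = ∈-cartesianProductWith⁺ _∷_ (all x) (∈-allVecs all v)

allVecs-unique : ∀ {a} {A : Set a} {xs : List A} → Unique xs →
                 ∀ m → Unique (allVecs xs m)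
allVecs-unique xs! zero    = [] ∷ []
allVecs-unique xs! (suc m) =
  Unique.cartesianProductWith⁺ _∷_ Vec.∷-injective xs! (allVecs-unique xs! m)

allMaps : ∀ m n → List (Vec (Fin n) m)
allMaps m n = allVecs (allFin n) m

allSubsets : ∀ m → List (Subset m)
allSubsets = allVecs (outside ∷ inside ∷ [])

∈-allMaps : ∀ {m n} (v : Vec (Fin n) m) → v ∈ₗ allMaps m n
∈-allMaps = ∈-allVecs ∈-allFin

allMaps-unique : ∀ m n → Unique (allMaps m n)
allMaps-unique m n = allVecs-unique (Unique.allFin⁺ n) m

∈-allSubsets : ∀ {m} (S : Subset m) → S ∈ₗ allSubsets m
∈-allSubsets = ∈-allVecs λ { false → here refl ; true → there (here refl) }

allSubsets-unique : ∀ m → Unique (allSubsets m)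
allSubsets-unique = allVecs-unique (((λ ()) ∷ []) ∷ [] ∷ [])

embed : ∀ {m} (S : Subset m) → Fin ∣ S ∣ → Fin m
embed (outside ∷ S) i       = suc (embed S i)
embed (inside  ∷ S) zero    = zero
embed (inside  ∷ S) (suc i) = suc (embed S i)

embed-injective : ∀ {m} (S : Subset m) → Injective _≡_ _≡_ (embed S)
embed-injective (outside ∷ S) e = embed-injective S (Fin.suc-injective e)
embed-injective (inside ∷ S) {zero}  {zero}  e = refl
embed-injective (inside ∷ S) {suc i} {suc j} e =
  cong suc (embed-injective S (Fin.suc-injective e))

embed-∈ : ∀ {m} (S : Subset m) i → embed S i ∈ S
embed-∈ (outside ∷ S) i       = there (embed-∈ S i)
embed-∈ (inside  ∷ S) zero    = here
embed-∈ (inside  ∷ S) (suc i) = there (embed-∈ S i)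

embed-surjective : ∀ {m} (S : Subset m) {x} → x ∈ S → ∃ λ i → embed S i ≡ x
embed-surjective (inside ∷ S) here = zero , refl
embed-surjective (outside ∷ S) (there x∈S) with embed-surjective S x∈S
... | i , e = i , cong suc e
embed-surjective (inside ∷ S) (there x∈S) with embed-surjective S x∈S
... | i , e = suc i , cong suc e

embed-mono-≤ : ∀ {m} (S : Subset m) {i j} → i Fin.≤ j → embed S i Fin.≤ embed S j
embed-mono-≤ (outside ∷ S) i≤j = s≤s (embed-mono-≤ S i≤j)
embed-mono-≤ (inside ∷ S) {zero}  {j}     i≤j       = z≤n
embed-mono-≤ (inside ∷ S) {suc i} {suc j} (s≤s i≤j) = s≤s (embed-mono-≤ S i≤j)

embed-mono-< : ∀ {m} (S : Subset m) {i j} → i Fin.< j → embed S i Fin.< embed S j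
embed-mono-< S i<j =
  ℕ.≤∧≢⇒< (embed-mono-≤ S (ℕ.<⇒≤ i<j))
           (λ e → Fin.<⇒≢ i<j (embed-injective S (Fin.toℕ-injective e)))

embed-cancel-≤ : ∀ {m} (S : Subset m) {i j} → embed S i Fin.≤ embed S j → i Fin.≤ j
embed-cancel-≤ S e = ℕ.≮⇒≥ λ j<i → ℕ.<⇒≱ (embed-mono-< S j<i) e

embed-cancel-< : ∀ {m} (S : Subset m) {i j} → embed S i Fin.< embed S j → i Fin.< j
embed-cancel-< S e = ℕ.≰⇒> λ j≤i → ℕ.<⇒≱ e (embed-mono-≤ S j≤i)

record LabeledPoset (m : ℕ) : Set₁ where
  infix 4 _≼_
  field
    _≼_               : Rel (Fin m) 0ℓ
    isDecPartialOrder : IsDecPartialOrder _≡_ _≼_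
    ω                 : Fin m → ℕ
    ω-positive        : ∀ x → 1 ℕ.≤ ω x
    ω-injective       : Injective _≡_ _≡_ ω

  open IsDecPartialOrder isDecPartialOrder public
    using (antisym)
    renaming (refl to ≼-refl; trans to ≼-trans; reflexive to ≼-reflexive;
              _≤?_ to _≼?_; _≟_ to _≟ᴾ_)

  open NonStrictToStrict _≡_ _≼_ public
    using () renaming (_<_ to _≺_)

  _≺?_ : ∀ x y → Dec (x ≺ y)
  _≺?_ = NonStrictToStrict.<-decidable _≡_ _≼_ _≟ᴾ_ _≼?_

  IsIdeal : Subset m → Set
  IsIdeal S = ∀ x y → y ∈ S → x ≼ y → x ∈ S

  IsNatural : Subset m → Set
  IsNatural S = ∀ x y → x ∈ S → y ∈ S → x ≼ y → ω x ℕ.≤ ω y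

  IsωOrderPreserving : ∀ {n} → (Fin m → Fin n) → Set
  IsωOrderPreserving f =
    (∀ x y → x ≼ y → f x Fin.≤ f y) ×
    (∀ x y → y ≺ x → ω x ℕ.< ω y → f y Fin.< f x)

  isIdeal? : Decidable IsIdeal
  isIdeal? S = Fin.all? λ x → Fin.all? λ y →
    (y ∈? S) →-dec ((x ≼? y) →-dec (x ∈? S))

  isNatural? : Decidable IsNatural
  isNatural? S = Fin.all? λ x → Fin.all? λ y →
    (x ∈? S) →-dec ((y ∈? S) →-dec ((x ≼? y) →-dec (ω x ℕ.≤? ω y)))

  isωOrderPreserving? : ∀ {n} → Decidable (IsωOrderPreserving {n})
  isωOrderPreserving? f =
    (Fin.all? λ x → Fin.all? λ y → (x ≼? y) →-dec (f x Fin.≤? f y)) ×-dec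
    (Fin.all? λ x → Fin.all? λ y →
      (y ≺? x) →-dec ((ω x ℕ.<? ω y) →-dec (f y Fin.<? f x)))

  nonemptyNaturalIdeals : List (Subset m)
  nonemptyNaturalIdeals =
    filter (λ S → nonempty? S ×-dec (isIdeal? S ×-dec isNatural? S)) (allSubsets m)

  ωOrderPreservingMaps : ∀ n → List (Vec (Fin n) m)
  ωOrderPreservingMaps n = filter (λ v → isωOrderPreserving? (lookup v)) (allMaps m n)

open LabeledPoset public
  using (IsIdeal; IsNatural; IsωOrderPreserving; nonemptyNaturalIdeals; ωOrderPreservingMaps)

-- The labeled poset on a subset S, transported to Fin ∣ S ∣ along the
-- enumeration of S.

induced : ∀ {m} → LabeledPoset m → (S : Subset m) → LabeledPoset ∣ S ∣
induced P S = record
  { _≼_ = λ x y → embed S x ≼ embed S y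
  ; isDecPartialOrder = record
    { isPartialOrder = record
      { isPreorder = record
        { isEquivalence = ≡.isEquivalence
        ; reflexive     = λ e → ≼-reflexive (cong (embed S) e)
        ; trans         = ≼-trans
        }
      ; antisym = λ x≼y y≼x → embed-injective S (antisym x≼y y≼x)
      }
    ; _≟_  = Fin._≟_
    ; _≤?_ = λ x y → embed S x ≼? embed S y
    }
  ; ω           = λ x → ω (embed S x)
  ; ω-positive  = λ x → ω-positive (embed S x)
  ; ω-injective = λ e → embed-injective S (ω-injective e)
  }
  where open LabeledPoset P

infixl 5 _∖_

_∖_ : ∀ {m} → LabeledPoset m → (S : Subset m) → LabeledPoset ∣ ∁ S ∣
P ∖ S = induced P (∁ S)

-- If s k is the number of surjective ω-order-preserving maps onto [k],
-- then the number of ω-order-preserving maps to [n] is the sum of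
-- s ∣ I ∣ over all I ⊆ [n].  This is what makes it polynomial in n.

image : ∀ {m n} → Vec (Fin n) m → Subset n
image []      = ⊥
image (x ∷ v) = ⁅ x ⁆ ∪ image v

∈-image⁺ : ∀ {m n} (v : Vec (Fin n) m) j → lookup v j ∈ image v
∈-image⁺ (x ∷ v) zero    = x∈p∪q⁺ (inj₁ (x∈⁅x⁆ x))
∈-image⁺ (x ∷ v) (suc j) = x∈p∪q⁺ (inj₂ (∈-image⁺ v j))

∈-image⁻ : ∀ {m n} (v : Vec (Fin n) m) {i} → i ∈ image v → ∃ λ j → lookup v j ≡ i
∈-image⁻ []      i∈ = ⊥-elim (∉⊥ i∈)
∈-image⁻ (x ∷ v) i∈ with x∈p∪q⁻ ⁅ x ⁆ (image v) i∈
... | inj₁ i∈x = zero , ≡.sym (x∈⁅y⁆⇒x≡y x i∈x)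
... | inj₂ i∈v with ∈-image⁻ v i∈v
...   | j , e = suc j , e

_≟ₛ_ : ∀ {n} → DecidableEquality (Subset n)
_≟ₛ_ = Vec.≡-dec Bool._≟_

map-injective : ∀ {a b} {A : Set a} {B : Set b} {f : A → B} → Injective _≡_ _≡_ f →
                ∀ {m} → Injective _≡_ _≡_ (Vec.map {n = m} f)
map-injective f-inj {x = []}    {y = []}    e = refl
map-injective f-inj {x = x ∷ u} {y = y ∷ v} e =
  cong₂ _∷_ (f-inj (Vec.∷-injectiveˡ e)) (map-injective f-inj (Vec.∷-injectiveʳ e))

module _ {a} {A : Set a} where

  remove : ∀ {x : A} {ys} → x ∈ₗ ys → List A
  remove {ys = y ∷ ys} (here _)   = ys
  remove {ys = y ∷ ys} (there x∈) = y ∷ remove x∈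

  length-remove : ∀ {x : A} {ys} (x∈ : x ∈ₗ ys) → length ys ≡ suc (length (remove x∈))
  length-remove (here _)   = refl
  length-remove (there x∈) = cong suc (length-remove x∈)

  ∈-remove : ∀ {x z : A} {ys} (x∈ : x ∈ₗ ys) → z ∈ₗ ys → x ≢ z → z ∈ₗ remove x∈
  ∈-remove (here refl) (here refl) x≢z = ⊥-elim (x≢z refl)
  ∈-remove (here refl) (there z∈)  x≢z = z∈
  ∈-remove (there x∈)  (here e)    x≢z = here e
  ∈-remove (there x∈)  (there z∈)  x≢z = there (∈-remove x∈ z∈ x≢z)

  unique⇒length-≤ : ∀ {xs ys : List A} → Unique xs → (∀ {z} → z ∈ₗ xs → z ∈ₗ ys) →
                    length xs ℕ.≤ length ys
  unique⇒length-≤ {[]}     []          sub = z≤n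
  unique⇒length-≤ {x ∷ xs} (x∉ ∷ xs!) sub =
    subst (suc (length xs) ℕ.≤_) (≡.sym (length-remove (sub (here refl))))
      (s≤s (unique⇒length-≤ xs! λ z∈ →
        ∈-remove (sub (here refl)) (sub (there z∈)) (All.lookup x∉ z∈)))

  unique⇒length-≡ : ∀ {xs ys : List A} → Unique xs → Unique ys →
                    (∀ {z} → z ∈ₗ xs → z ∈ₗ ys) → (∀ {z} → z ∈ₗ ys → z ∈ₗ xs) →
                    length xs ≡ length ys
  unique⇒length-≡ xs! ys! f g =
    ℕ.≤-antisym (unique⇒length-≤ xs! f) (unique⇒length-≤ ys! g)

  sum-map-+ : ∀ (f g : A → ℕ) ys →
              sum (map (λ y → f y ℕ.+ g y) ys) ≡ sum (map f ys) ℕ.+ sum (map g ys)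
  sum-map-+ f g []       = refl
  sum-map-+ f g (y ∷ ys) = begin
    f y ℕ.+ g y ℕ.+ sum (map (λ y → f y ℕ.+ g y) ys)
      ≡⟨ cong (f y ℕ.+ g y ℕ.+_) (sum-map-+ f g ys) ⟩
    f y ℕ.+ g y ℕ.+ (sum (map f ys) ℕ.+ sum (map g ys))
      ≡⟨ ℕ.+-assoc (f y) (g y) _ ⟩
    f y ℕ.+ (g y ℕ.+ (sum (map f ys) ℕ.+ sum (map g ys)))
      ≡⟨ cong (f y ℕ.+_) (ℕ.+-assoc (g y) _ _) ⟨
    f y ℕ.+ (g y ℕ.+ sum (map f ys) ℕ.+ sum (map g ys))
      ≡⟨ cong (λ z → f y ℕ.+ (z ℕ.+ sum (map g ys))) (ℕ.+-comm (g y) _) ⟩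
    f y ℕ.+ (sum (map f ys) ℕ.+ g y ℕ.+ sum (map g ys))
      ≡⟨ cong (f y ℕ.+_) (ℕ.+-assoc (sum (map f ys)) _ _) ⟩
    f y ℕ.+ (sum (map f ys) ℕ.+ (g y ℕ.+ sum (map g ys)))
      ≡⟨ ℕ.+-assoc (f y) _ _ ⟨
    f y ℕ.+ sum (map f ys) ℕ.+ (g y ℕ.+ sum (map g ys)) ∎
    where open ≡-Reasoning

  sum-map-0 : ∀ (f : A → ℕ) ys → (∀ {y} → y ∈ₗ ys → f y ≡ 0) → sum (map f ys) ≡ 0
  sum-map-0 f []       f≡0 = refl
  sum-map-0 f (y ∷ ys) f≡0 =
    cong₂ ℕ._+_ (f≡0 (here refl)) (sum-map-0 f ys (f≡0 ∘ there))

  sum-map-cong : ∀ {f g : A → ℕ} → (∀ y → f y ≡ g y) →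
                 ∀ ys → sum (map f ys) ≡ sum (map g ys)
  sum-map-cong f≡g ys = cong sum (List.map-cong f≡g ys)

module _ {a b} {A : Set a} {B : Set b} (_≟_ : DecidableEquality B) (f : A → B) where

  fibre : List A → B → List A
  fibre xs y = filter (λ x → f x ≟ y) xs

  indicator : B → B → ℕ
  indicator b y with b ≟ y
  ... | yes _ = 1
  ... | no  _ = 0

  length-fibre-∷ : ∀ x xs y → length (fibre (x ∷ xs) y) ≡
                              indicator (f x) y ℕ.+ length (fibre xs y)
  length-fibre-∷ x xs y with f x ≟ y
  ... | yes e = refl
  ... | no  _ = refl

  sum-indicator : ∀ b {ys} → Unique ys → b ∈ₗ ys → sum (map (indicator b) ys) ≡ 1
  sum-indicator b {y ∷ ys} (y∉ ∷ ys!) b∈ with b ≟ y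
  ... | yes refl = cong suc (sum-map-0 (indicator b) ys zeros)
    where
    zeros : ∀ {z} → z ∈ₗ ys → indicator b z ≡ 0
    zeros {z} z∈ with b ≟ z
    ... | yes e = ⊥-elim (All.lookup y∉ z∈ e)
    ... | no  _ = refl
  ... | no b≢y with b∈
  ...   | here e   = ⊥-elim (b≢y e)
  ...   | there b∈ = sum-indicator b ys! b∈

  length-fibres : ∀ {ys} → Unique ys → (∀ b → b ∈ₗ ys) →
                  ∀ xs → length xs ≡ sum (map (length ∘ fibre xs) ys)
  length-fibres {ys} ys! all []       = ≡.sym (sum-map-0 _ ys λ _ → refl)
  length-fibres {ys} ys! all (x ∷ xs) = begin
    1 ℕ.+ length xs
      ≡⟨ cong₂ ℕ._+_ (≡.sym (sum-indicator (f x) ys! (all (f x))))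
                     (length-fibres ys! all xs) ⟩
    sum (map (indicator (f x)) ys) ℕ.+ sum (map (length ∘ fibre xs) ys)
      ≡⟨ sum-map-+ (indicator (f x)) (length ∘ fibre xs) ys ⟨
    sum (map (λ y → indicator (f x) y ℕ.+ length (fibre xs y)) ys)
      ≡⟨ sum-map-cong (length-fibre-∷ x xs) ys ⟨
    sum (map (length ∘ fibre (x ∷ xs)) ys) ∎
    where open ≡-Reasoning

sumOverSubsets : (ℕ → ℕ) → ℕ → ℕ
sumOverSubsets s n = sum (map (λ I → s ∣ I ∣) (allSubsets n))

sumOverSubsets-suc : ∀ s n → sumOverSubsets s (suc n) ≡
                             sumOverSubsets s n ℕ.+ sumOverSubsets (s ∘ suc) n
sumOverSubsets-suc s n = begin
  sum (map f (map (outside ∷_) L ++ (map (inside ∷_) L ++ [])))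
    ≡⟨ cong (λ z → sum (map f (map (outside ∷_) L ++ z))) (List.++-identityʳ _) ⟩
  sum (map f (map (outside ∷_) L ++ map (inside ∷_) L))
    ≡⟨ cong sum (List.map-++ f (map (outside ∷_) L) _) ⟩
  sum (map f (map (outside ∷_) L) ++ map f (map (inside ∷_) L))
    ≡⟨ sum-++ (map f (map (outside ∷_) L)) _ ⟩
  sum (map f (map (outside ∷_) L)) ℕ.+ sum (map f (map (inside ∷_) L))
    ≡⟨ cong₂ (λ y z → sum y ℕ.+ sum z) (List.map-∘ L) (List.map-∘ L) ⟨
  sumOverSubsets s n ℕ.+ sumOverSubsets (s ∘ suc) n ∎
  where
  open ≡-Reasoning
  L = allSubsets n
  f : Subset (suc n) → ℕ
  f I = s ∣ I ∣

module _ {m} (P : LabeledPoset m) where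

  mapsWithImage : ∀ {n} → Subset n → List (Vec (Fin n) m)
  mapsWithImage {n} = fibre _≟ₛ_ image (ωOrderPreservingMaps P n)

  numSurjections : ℕ → ℕ
  numSurjections k = length (mapsWithImage (⊤ {k}))

  mapsWithImage-unique : ∀ {n} (I : Subset n) → Unique (mapsWithImage I)
  mapsWithImage-unique {n} I =
    Unique.filter⁺ _ (Unique.filter⁺ _ (allMaps-unique m n))

  ∈-mapsWithImage⁻ : ∀ {n} {I : Subset n} {v} → v ∈ₗ mapsWithImage I →
                     IsωOrderPreserving P (lookup v) × image v ≡ I
  ∈-mapsWithImage⁻ {n} v∈ with ∈-filter⁻ _ {xs = ωOrderPreservingMaps P n} v∈
  ... | v∈′ , e = proj₂ (∈-filter⁻ _ {xs = allMaps m n} v∈′) , e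

  ∈-mapsWithImage⁺ : ∀ {n} {I : Subset n} {v} → IsωOrderPreserving P (lookup v) →
                     image v ≡ I → v ∈ₗ mapsWithImage I
  ∈-mapsWithImage⁺ {v = v} op e = ∈-filter⁺ _ (∈-filter⁺ _ (∈-allMaps v) op) e

  module _ {n} (I : Subset n) where

    preserving-embed⁺ : (v : Vec (Fin ∣ I ∣) m) → IsωOrderPreserving P (lookup v) →
                        IsωOrderPreserving P (lookup (Vec.map (embed I) v))
    preserving-embed⁺ v (mono , strict)
      = (λ x y x≼y → ≡.subst₂ Fin._≤_ (≡.sym (Vec.lookup-map x _ v)) (≡.sym (Vec.lookup-map y _ v))
                       (embed-mono-≤ I (mono x y x≼y)))
      , (λ x y y≺x l → ≡.subst₂ Fin._<_ (≡.sym (Vec.lookup-map y _ v)) (≡.sym (Vec.lookup-map x _ v))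
                         (embed-mono-< I (strict x y y≺x l)))

    preserving-embed⁻ : (v : Vec (Fin ∣ I ∣) m) →
                        IsωOrderPreserving P (lookup (Vec.map (embed I) v)) →
                        IsωOrderPreserving P (lookup v)
    preserving-embed⁻ v (mono , strict)
      = (λ x y x≼y → embed-cancel-≤ I
           (≡.subst₂ Fin._≤_ (Vec.lookup-map x _ v) (Vec.lookup-map y _ v) (mono x y x≼y)))
      , (λ x y y≺x l → embed-cancel-< I
           (≡.subst₂ Fin._<_ (Vec.lookup-map y _ v) (Vec.lookup-map x _ v) (strict x y y≺x l)))

    image-embed⁺ : (v : Vec (Fin ∣ I ∣) m) → image v ≡ ⊤ → image (Vec.map (embed I) v) ≡ I
    image-embed⁺ v e = ⊆-antisym fwd bwd
      where
      fwd : image (Vec.map (embed I) v) ⊆ I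
      fwd x∈ with ∈-image⁻ (Vec.map (embed I) v) x∈
      ... | j , refl = subst (_∈ I) (≡.sym (Vec.lookup-map j _ v)) (embed-∈ I (lookup v j))
      bwd : I ⊆ image (Vec.map (embed I) v)
      bwd x∈ with embed-surjective I x∈
      ... | i , refl with ∈-image⁻ v (subst (i ∈_) (≡.sym e) ∈⊤)
      ...   | j , refl = subst (_∈ image (Vec.map (embed I) v)) (Vec.lookup-map j _ v)
                           (∈-image⁺ (Vec.map (embed I) v) j)

    image-embed⁻ : (v : Vec (Fin ∣ I ∣) m) → image (Vec.map (embed I) v) ≡ I → image v ≡ ⊤
    image-embed⁻ v e = ⊆-antisym (⊆-max _) bwd
      where
      bwd : ⊤ ⊆ image v
      bwd {i} _ with ∈-image⁻ (Vec.map (embed I) v) (subst (embed I i ∈_) (≡.sym e) (embed-∈ I i))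
      ... | j , e′ with embed-injective I (≡.trans (≡.sym (Vec.lookup-map j _ v)) e′)
      ...   | refl = ∈-image⁺ v j

    preimage : ∀ {k} (v : Vec (Fin n) k) → image v ⊆ I → ∃ λ u → Vec.map (embed I) u ≡ v
    preimage []      sub = [] , refl
    preimage (x ∷ v) sub with embed-surjective I (sub (∈-image⁺ (x ∷ v) zero))
                            | preimage v (sub ∘ λ i∈ → x∈p∪q⁺ (inj₂ i∈))
    ... | i , refl | u , refl = (i ∷ u) , refl

    length-mapsWithImage : length (mapsWithImage I) ≡ numSurjections ∣ I ∣
    length-mapsWithImage = ≡.trans
      (unique⇒length-≡ (mapsWithImage-unique I)
        (Unique.map⁺ (map-injective (embed-injective I)) (mapsWithImage-unique ⊤))
        fwd bwd)
      (List.length-map (Vec.map (embed I)) (mapsWithImage ⊤))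
      where
      fwd : ∀ {v} → v ∈ₗ mapsWithImage I → v ∈ₗ map (Vec.map (embed I)) (mapsWithImage ⊤)
      fwd {v} v∈ with ∈-mapsWithImage⁻ {I = I} v∈
      ... | op , e with preimage v (λ {x} → subst (x ∈_) e)
      ...   | u , refl = ∈-map⁺ _ (∈-mapsWithImage⁺ (preserving-embed⁻ u op) (image-embed⁻ u e))
      bwd : ∀ {v} → v ∈ₗ map (Vec.map (embed I)) (mapsWithImage ⊤) → v ∈ₗ mapsWithImage I
      bwd v∈ with ∈-map⁻ (Vec.map (embed I)) v∈
      ... | u , u∈ , refl with ∈-mapsWithImage⁻ {I = ⊤} u∈
      ...   | op , e = ∈-mapsWithImage⁺ (preserving-embed⁺ u op) (image-embed⁺ u e)

  length-ωOrderPreservingMaps : ∀ n → length (ωOrderPreservingMaps P n) ≡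
                                      sumOverSubsets numSurjections n
  length-ωOrderPreservingMaps n = ≡.trans
    (length-fibres _≟ₛ_ image (allSubsets-unique n) ∈-allSubsets (ωOrderPreservingMaps P n))
    (sum-map-cong length-mapsWithImage (allSubsets n))

  numSurjections-vanishes : ∀ k → suc m ℕ.≤ k → numSurjections k ≡ 0
  numSurjections-vanishes k m<k with mapsWithImage (⊤ {k}) in eq
  ... | []    = refl
  ... | v ∷ _ = ⊥-elim (ℕ.<⇒≱ m<k (Fin.injective⇒≤ section-injective))
    where
    onto : ∀ i → ∃ λ j → lookup v j ≡ i
    onto i = ∈-image⁻ v (subst (i ∈_)
      (≡.sym (proj₂ (∈-mapsWithImage⁻ {I = ⊤} (subst (v ∈ₗ_) (≡.sym eq) (here refl))))) ∈⊤)
    section-injective : Injective _≡_ _≡_ (proj₁ ∘ onto)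
    section-injective {i} {i′} e =
      ≡.trans (≡.sym (proj₂ (onto i))) (≡.trans (cong (lookup v) e) (proj₂ (onto i′)))

-- The library has no field ℂ.  Coefficients are taken in an arbitrary
-- field of characteristic 0, of which ℂ is an instance.  Equality in K
-- need not be decidable; "nonzero" means apart from 0.

fieldRing : ∀ {c ℓ₁ ℓ₂} → HeytingField c ℓ₁ ℓ₂ → CommutativeRing c ℓ₁
fieldRing K = HeytingCommutativeRing.commutativeRing (HeytingField.heytingCommutativeRing K)

natural : ∀ {c ℓ₁ ℓ₂} (K : HeytingField c ℓ₁ ℓ₂) → ℕ → HeytingField.Carrier K
natural K n = n · HeytingField.1# K
  where open Multiples (CommutativeRing.semiring (fieldRing K)) using () renaming (_×_ to _·_)

CharacteristicZero : ∀ {c ℓ₁ ℓ₂} → HeytingField c ℓ₁ ℓ₂ → Set ℓ₂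
CharacteristicZero K = ∀ n → HeytingField._#_ K (natural K (suc n)) (HeytingField.0# K)

module Polynomials {c ℓ₁ ℓ₂ : Level} (K : HeytingField c ℓ₁ ℓ₂) (char0 : CharacteristicZero K) where

  open CommutativeRing (fieldRing K) hiding (zero) renaming
    (refl to ≈-refl; sym to ≈-sym; trans to ≈-trans; reflexive to ≈-reflexive)
  open RingProperties ring using (-0#≈0#; -‿distribˡ-*; -‿+-comm)
  open GroupProperties +-group using () renaming (x∙y⁻¹≈ε⇒x≈y to x-y≈0⇒x≈y)
  open Multiples semiring using () renaming (×-homo-+ to ·-homo-+)
  open RingSolver commutativeSemiring using (solve; _:=_; _:+_; _:*_)
  open ≈-Reasoning setoid

  fromℕ : ℕ → Carrier
  fromℕ = natural K

  -- The list a₀ ∷ a₁ ∷ … ∷ [] is the polynomial a₀ + a₁ t + ….  Trailing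
  -- zeros are allowed and disregarded by _≈ₚ_.

  Poly : Set c
  Poly = List Carrier

  coeff : Poly → ℕ → Carrier
  coeff []      i       = 0#
  coeff (a ∷ p) zero    = a
  coeff (a ∷ p) (suc i) = coeff p i

  infix 4 _≈ₚ_

  _≈ₚ_ : Rel Poly ℓ₁
  p ≈ₚ q = ∀ i → coeff p i ≈ coeff q i

  eval : Poly → Carrier → Carrier
  eval []      x = 0#
  eval (a ∷ p) x = a + x * eval p x

  infixl 6 _+ₚ_
  infixr 7 _*ₚ_
  infix  8 -ₚ_

  _+ₚ_ : Poly → Poly → Poly
  []      +ₚ q       = q
  (a ∷ p) +ₚ []      = a ∷ p
  (a ∷ p) +ₚ (b ∷ q) = (a + b) ∷ (p +ₚ q)

  _*ₚ_ : Carrier → Poly → Poly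
  a *ₚ p = map (a *_) p

  -ₚ_ : Poly → Poly
  -ₚ p = map -_ p

  sumₚ : List Poly → Poly
  sumₚ = foldr _+ₚ_ []

  -- p(t + 1), by Horner's rule: if p = a + t p′ then
  -- p(t + 1) = a + p′(t + 1) + t p′(t + 1).

  shift : Poly → Poly
  shift []      = []
  shift (a ∷ p) = (a ∷ []) +ₚ (shift p +ₚ (0# ∷ shift p))

  Δ : Poly → Poly
  Δ p = shift p +ₚ (-ₚ p)

  IsAntidifference : Poly → Poly → Set ℓ₁
  IsAntidifference f g = (eval g 0# ≈ 0#) × (Δ g ≈ₚ f)

  IsOrderPolynomial : ∀ {m} → LabeledPoset m → Poly → Set ℓ₁
  IsOrderPolynomial P p =
    ∀ n → 1 ℕ.≤ n → eval p (fromℕ n) ≈ fromℕ (length (ωOrderPreservingMaps P n))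

  coeff-+ : ∀ p q i → coeff (p +ₚ q) i ≈ coeff p i + coeff q i
  coeff-+ []      q       i       = ≈-sym (+-identityˡ _)
  coeff-+ (a ∷ p) []      i       = ≈-sym (+-identityʳ _)
  coeff-+ (a ∷ p) (b ∷ q) zero    = ≈-refl
  coeff-+ (a ∷ p) (b ∷ q) (suc i) = coeff-+ p q i

  coeff-neg : ∀ p i → coeff (-ₚ p) i ≈ - coeff p i
  coeff-neg []      i       = ≈-sym -0#≈0#
  coeff-neg (a ∷ p) zero    = ≈-refl
  coeff-neg (a ∷ p) (suc i) = coeff-neg p i

  eval-zero : ∀ p → (∀ i → coeff p i ≈ 0#) → ∀ x → eval p x ≈ 0#
  eval-zero []      p≈0 x = ≈-refl
  eval-zero (a ∷ p) p≈0 x = begin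
    a + x * eval p x ≈⟨ +-cong (p≈0 0) (*-congˡ (eval-zero p (p≈0 ∘ suc) x)) ⟩
    0# + x * 0#      ≈⟨ +-identityˡ _ ⟩
    x * 0#           ≈⟨ zeroʳ x ⟩
    0#               ∎

  eval-cong : ∀ p q → p ≈ₚ q → ∀ {x y} → x ≈ y → eval p x ≈ eval q y
  eval-cong []      q       e x≈y = ≈-sym (eval-zero q (λ i → ≈-sym (e i)) _)
  eval-cong (a ∷ p) []      e x≈y = eval-zero (a ∷ p) e _
  eval-cong (a ∷ p) (b ∷ q) e x≈y =
    +-cong (e 0) (*-cong x≈y (eval-cong p q (e ∘ suc) x≈y))

  eval-congʳ : ∀ p {x y} → x ≈ y → eval p x ≈ eval p y
  eval-congʳ p = eval-cong p p (λ _ → ≈-refl)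

  eval-+ : ∀ p q x → eval (p +ₚ q) x ≈ eval p x + eval q x
  eval-+ []      q       x = ≈-sym (+-identityˡ _)
  eval-+ (a ∷ p) []      x = ≈-sym (+-identityʳ _)
  eval-+ (a ∷ p) (b ∷ q) x = begin
    a + b + x * eval (p +ₚ q) x            ≈⟨ +-congˡ (*-congˡ (eval-+ p q x)) ⟩
    a + b + x * (eval p x + eval q x)      ≈⟨ solve 5 (λ a b x y z →
      a :+ b :+ x :* (y :+ z) := a :+ x :* y :+ (b :+ x :* z)) ≈-refl a b x _ _ ⟩
    a + x * eval p x + (b + x * eval q x)  ∎

  eval-* : ∀ a p x → eval (a *ₚ p) x ≈ a * eval p x
  eval-* a []      x = ≈-sym (zeroʳ a)
  eval-* a (b ∷ p) x = begin
    a * b + x * eval (a *ₚ p) x   ≈⟨ +-congˡ (*-congˡ (eval-* a p x)) ⟩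
    a * b + x * (a * eval p x)    ≈⟨ solve 4 (λ a b x y →
      a :* b :+ x :* (a :* y) := a :* (b :+ x :* y)) ≈-refl a b x _ ⟩
    a * (b + x * eval p x)        ∎

  eval-neg : ∀ p x → eval (-ₚ p) x ≈ - eval p x
  eval-neg []      x = ≈-sym -0#≈0#
  eval-neg (a ∷ p) x = begin
    - a + x * eval (-ₚ p) x   ≈⟨ +-congˡ (*-congˡ (eval-neg p x)) ⟩
    - a + x * - eval p x      ≈⟨ +-congˡ (*-comm x _) ⟩
    - a + - eval p x * x      ≈⟨ +-congˡ (-‿distribˡ-* _ x) ⟨
    - a + - (eval p x * x)    ≈⟨ +-congˡ (-‿cong (*-comm _ x)) ⟩
    - a + - (x * eval p x)    ≈⟨ -‿+-comm a _ ⟩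
    - (a + x * eval p x)      ∎

  eval-shift : ∀ p x → eval (shift p) x ≈ eval p (x + 1#)
  eval-shift []      x = ≈-refl
  eval-shift (a ∷ p) x = begin
    eval ((a ∷ []) +ₚ (s +ₚ (0# ∷ s))) x     ≈⟨ eval-+ (a ∷ []) (s +ₚ (0# ∷ s)) x ⟩
    a + x * 0# + eval (s +ₚ (0# ∷ s)) x      ≈⟨ +-cong (+-congˡ (zeroʳ x)) (eval-+ s (0# ∷ s) x) ⟩
    a + 0# + (eval s x + (0# + x * eval s x))
      ≈⟨ +-cong (+-identityʳ a) (+-cong (≈-sym (*-identityˡ _)) (+-identityˡ _)) ⟩
    a + (1# * eval s x + x * eval s x)
      ≈⟨ solve 4 (λ a x y e → a :+ (e :* y :+ x :* y) := a :+ (x :+ e) :* y) ≈-refl a x _ 1# ⟩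
    a + (x + 1#) * eval s x                   ≈⟨ +-congˡ (*-congˡ (eval-shift p x)) ⟩
    a + (x + 1#) * eval p (x + 1#)            ∎
    where s = shift p

  x+y-y≈x : ∀ x y → x + y + - y ≈ x
  x+y-y≈x x y = begin
    x + y + - y    ≈⟨ +-assoc x y _ ⟩
    x + (y + - y)  ≈⟨ +-congˡ (-‿inverseʳ y) ⟩
    x + 0#         ≈⟨ +-identityʳ x ⟩
    x              ∎

  x-y+y≈x : ∀ x y → x + - y + y ≈ x
  x-y+y≈x x y = begin
    x + - y + y    ≈⟨ +-assoc x _ y ⟩
    x + (- y + y)  ≈⟨ +-congˡ (-‿inverseˡ y) ⟩
    x + 0#         ≈⟨ +-identityʳ x ⟩
    x              ∎

  eval-Δ : ∀ p x → eval (Δ p) x ≈ eval p (x + 1#) + - eval p x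
  eval-Δ p x = ≈-trans (eval-+ (shift p) _ x) (+-cong (eval-shift p x) (eval-neg p x))

  eval-suc : ∀ p n → eval p (fromℕ (suc n)) ≈ eval (Δ p) (fromℕ n) + eval p (fromℕ n)
  eval-suc p n = begin
    eval p (1# + fromℕ n)                            ≈⟨ eval-congʳ p (+-comm 1# _) ⟩
    eval p (fromℕ n + 1#)                            ≈⟨ x-y+y≈x _ (eval p (fromℕ n)) ⟨
    eval p (fromℕ n + 1#) + - eval p (fromℕ n) + eval p (fromℕ n)
                                                     ≈⟨ +-congʳ (eval-Δ p _) ⟨
    eval (Δ p) (fromℕ n) + eval p (fromℕ n)          ∎

  eval-sum : ∀ ps x → eval (sumₚ ps) x ≈ foldr (λ p y → eval p x + y) 0# ps
  eval-sum []       x = ≈-refl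
  eval-sum (p ∷ ps) x = ≈-trans (eval-+ p (sumₚ ps) x) (+-congˡ (eval-sum ps x))

  fromℕ-inverse : ∀ k → ∃ λ y → y * fromℕ (suc k) ≈ 1#
  fromℕ-inverse k with HeytingField.#⇒invertible K (char0 k)
  ... | y , e , _ = y , ≈-trans (*-congˡ (≈-sym k-0≈k)) e
    where
    k-0≈k : fromℕ (suc k) + - 0# ≈ fromℕ (suc k)
    k-0≈k = ≈-trans (+-congˡ -0#≈0#) (+-identityʳ _)

  -- The quotient of a ∷ p by t - c; it does not depend on a.

  quotient : Carrier → Poly → Poly
  quotient c []      = []
  quotient c (b ∷ p) = eval (b ∷ p) c ∷ quotient c p

  length-quotient : ∀ c p → length (quotient c p) ≡ length p
  length-quotient c []      = refl
  length-quotient c (b ∷ p) = cong suc (length-quotient c p)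

  eval-quotient : ∀ c d a p → eval (a ∷ p) (c + d) ≈ eval (a ∷ p) c + d * eval (quotient c p) (c + d)
  eval-quotient c d a [] = begin
    a + (c + d) * 0#       ≈⟨ +-congˡ (distribʳ 0# c d) ⟩
    a + (c * 0# + d * 0#)  ≈⟨ +-assoc a _ _ ⟨
    a + c * 0# + d * 0#    ∎
  eval-quotient c d a (b ∷ p) = begin
    a + (c + d) * eval (b ∷ p) (c + d)        ≈⟨ +-congˡ (*-congˡ (eval-quotient c d b p)) ⟩
    a + (c + d) * (P + d * Q)                 ≈⟨ solve 5 (λ a c d P Q →
      a :+ (c :+ d) :* (P :+ d :* Q) := a :+ c :* P :+ d :* (P :+ (c :+ d) :* Q))
      ≈-refl a c d P Q ⟩
    a + c * P + d * (P + (c + d) * Q)         ∎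
    where
    P = eval (b ∷ p) c
    Q = eval (quotient c p) (c + d)

  quotient-zero : ∀ c p → (∀ i → coeff (quotient c p) i ≈ 0#) →
                  (eval p c ≈ 0#) × (∀ i → coeff p i ≈ 0#)
  quotient-zero c []      q≈0 = ≈-refl , λ i → ≈-refl
  quotient-zero c (b ∷ p) q≈0 = q≈0 0 , λ
    { zero    → begin
        b                 ≈⟨ +-identityʳ b ⟨
        b + 0#            ≈⟨ +-congˡ (zeroʳ c) ⟨
        b + c * 0#        ≈⟨ +-congˡ (*-congˡ (proj₁ ih)) ⟨
        b + c * eval p c  ≈⟨ q≈0 0 ⟩
        0#                ∎
    ; (suc i) → proj₂ ih i }
    where ih = quotient-zero c p (q≈0 ∘ suc)

  vanishing : ∀ N p → length p ℕ.≤ N → ∀ c → (∀ n → c ℕ.≤ n → eval p (fromℕ n) ≈ 0#) →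
              ∀ i → coeff p i ≈ 0#
  vanishing N       []      _       c p≈0 i = ≈-refl
  vanishing (suc N) (a ∷ p) (s≤s l) c p≈0   = λ
    { zero    → begin
        a                         ≈⟨ +-identityʳ a ⟨
        a + 0#                    ≈⟨ +-congˡ (zeroʳ _) ⟨
        a + fromℕ c * 0#          ≈⟨ +-congˡ (*-congˡ (proj₁ qz)) ⟨
        a + fromℕ c * eval p (fromℕ c) ≈⟨ p≈0 c ℕ.≤-refl ⟩
        0#                        ∎
    ; (suc i) → proj₂ qz i }
    where
    q = quotient (fromℕ c) p
    root : ∀ k → eval q (fromℕ (c ℕ.+ suc k)) ≈ 0#
    root k with fromℕ-inverse k
    ... | y , e = begin
      eval q x                    ≈⟨ *-identityˡ _ ⟨
      1# * eval q x               ≈⟨ *-congʳ e ⟨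
      y * d * eval q x            ≈⟨ *-assoc y d _ ⟩
      y * (d * eval q x)          ≈⟨ *-congˡ dq≈0 ⟩
      y * 0#                      ≈⟨ zeroʳ y ⟩
      0#                          ∎
      where
      d = fromℕ (suc k)
      x = fromℕ (c ℕ.+ suc k)
      x≈c+d : x ≈ fromℕ c + d
      x≈c+d = ·-homo-+ 1# c (suc k)
      dq≈0 : d * eval q x ≈ 0#
      dq≈0 = begin
        d * eval q x                                    ≈⟨ *-congˡ (eval-congʳ q x≈c+d) ⟩
        d * eval q (fromℕ c + d)                        ≈⟨ +-identityˡ _ ⟨
        0# + d * eval q (fromℕ c + d)                   ≈⟨ +-congʳ (p≈0 c ℕ.≤-refl) ⟨
        eval (a ∷ p) (fromℕ c) + d * eval q (fromℕ c + d) ≈⟨ eval-quotient (fromℕ c) d a p ⟨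
        eval (a ∷ p) (fromℕ c + d)                      ≈⟨ eval-congʳ (a ∷ p) x≈c+d ⟨
        eval (a ∷ p) x                                  ≈⟨ p≈0 _ (ℕ.m≤m+n c (suc k)) ⟩
        0#                                              ∎
    q-vanishes : ∀ n → suc c ℕ.≤ n → eval q (fromℕ n) ≈ 0#
    q-vanishes n c<n with ℕ.m≤n⇒∃[o]m+o≡n c<n
    ... | k , refl = subst (λ z → eval q (fromℕ z) ≈ 0#) (ℕ.+-suc c k) (root k)
    qz = quotient-zero (fromℕ c) p
      (vanishing N q (subst (ℕ._≤ N) (≡.sym (length-quotient (fromℕ c) p)) l) (suc c) q-vanishes)

  values-determine : ∀ p q → (∀ n → 1 ℕ.≤ n → eval p (fromℕ n) ≈ eval q (fromℕ n)) → p ≈ₚ q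
  values-determine p q e i = x-y≈0⇒x≈y _ _ (begin
    coeff p i + - coeff q i      ≈⟨ +-congˡ (coeff-neg q i) ⟨
    coeff p i + coeff (-ₚ q) i   ≈⟨ coeff-+ p (-ₚ q) i ⟨
    coeff (p +ₚ (-ₚ q)) i        ≈⟨ vanishing _ (p +ₚ (-ₚ q)) ℕ.≤-refl 1 root i ⟩
    0#                           ∎)
    where
    root : ∀ n → 1 ℕ.≤ n → eval (p +ₚ (-ₚ q)) (fromℕ n) ≈ 0#
    root n 1≤n = begin
      eval (p +ₚ (-ₚ q)) x         ≈⟨ eval-+ p (-ₚ q) x ⟩
      eval p x + eval (-ₚ q) x     ≈⟨ +-cong (e n 1≤n) (eval-neg q x) ⟩
      eval q x + - eval q x        ≈⟨ -‿inverseʳ _ ⟩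
      0#                           ∎
      where x = fromℕ n

  -- t (t - 1) ⋯ (t - k + 1)

  falling : ℕ → Poly
  falling zero    = 1# ∷ []
  falling (suc k) = (0# ∷ falling k) +ₚ (- fromℕ k) *ₚ falling k

  eval-falling : ∀ k x → eval (falling (suc k)) x ≈ (x + - fromℕ k) * eval (falling k) x
  eval-falling k x = begin
    eval (falling (suc k)) x                ≈⟨ eval-+ (0# ∷ falling k) ((- fromℕ k) *ₚ falling k) x ⟩
    0# + x * F + eval ((- fromℕ k) *ₚ falling k) x
                                            ≈⟨ +-cong (+-identityˡ _) (eval-* _ (falling k) x) ⟩
    x * F + - fromℕ k * F                   ≈⟨ distribʳ F x _ ⟨
    (x + - fromℕ k) * F                     ∎
    where F = eval (falling k) x

  falling-0 : ∀ k → eval (falling (suc k)) 0# ≈ 0#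
  falling-0 zero = ≈-trans (eval-falling 0 0#)
    (≈-trans (*-congʳ (≈-trans (+-identityˡ _) -0#≈0#)) (zeroˡ _))
  falling-0 (suc k) = ≈-trans (eval-falling (suc k) 0#) (≈-trans (*-congˡ (falling-0 k)) (zeroʳ _))

  eval-falling-+1 : ∀ k x → eval (falling (suc k)) (x + 1#) ≈ (x + 1#) * eval (falling k) x
  eval-falling-+1 zero x = begin
    eval (falling 1) (x + 1#)                   ≈⟨ eval-falling 0 (x + 1#) ⟩
    (x + 1# + - 0#) * (1# + (x + 1#) * 0#)      ≈⟨ *-cong (≈-trans (+-congˡ -0#≈0#) (+-identityʳ _))
                                                     (+-congˡ (≈-trans (zeroʳ _) (≈-sym (zeroʳ x)))) ⟩
    (x + 1#) * (1# + x * 0#)                    ∎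
  eval-falling-+1 (suc k) x = begin
    eval (falling (suc (suc k))) (x + 1#)                        ≈⟨ eval-falling (suc k) (x + 1#) ⟩
    (x + 1# + - fromℕ (suc k)) * eval (falling (suc k)) (x + 1#) ≈⟨ *-cong x+1-k-1 (eval-falling-+1 k x) ⟩
    (x + - fromℕ k) * ((x + 1#) * F)    ≈⟨ solve 3 (λ x y z → x :* (y :* z) := y :* (x :* z)) ≈-refl _ _ F ⟩
    (x + 1#) * ((x + - fromℕ k) * F)    ≈⟨ *-congˡ (eval-falling k x) ⟨
    (x + 1#) * eval (falling (suc k)) x ∎
    where
    F = eval (falling k) x
    x+1-k-1 : x + 1# + - fromℕ (suc k) ≈ x + - fromℕ k
    x+1-k-1 = begin
      x + 1# + - (1# + fromℕ k)       ≈⟨ +-congˡ (-‿+-comm 1# _) ⟨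
      x + 1# + (- 1# + - fromℕ k)     ≈⟨ +-assoc _ _ _ ⟨
      x + 1# + - 1# + - fromℕ k       ≈⟨ +-congʳ (x+y-y≈x x 1#) ⟩
      x + - fromℕ k                   ∎

  falling-step : ∀ k x → eval (falling (suc k)) (x + 1#) ≈
                 eval (falling (suc k)) x + fromℕ (suc k) * eval (falling k) x
  falling-step k x = begin
    eval (falling (suc k)) (x + 1#)                     ≈⟨ eval-falling-+1 k x ⟩
    (x + 1#) * F                                        ≈⟨ *-congʳ (+-congʳ (x-y+y≈x x (fromℕ k))) ⟨
    (x + - fromℕ k + fromℕ k + 1#) * F                  ≈⟨ solve 4 (λ d k e F →
      (d :+ k :+ e) :* F := d :* F :+ (e :+ k) :* F) ≈-refl (x + - fromℕ k) (fromℕ k) 1# F ⟩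
    (x + - fromℕ k) * F + fromℕ (suc k) * F             ≈⟨ +-congʳ (eval-falling k x) ⟨
    eval (falling (suc k)) x + fromℕ (suc k) * F        ∎
    where F = eval (falling k) x

  antidifference-falling : ∀ N k p → length p ℕ.≤ N →
    ∃ λ g → (eval g 0# ≈ 0#) ×
            (∀ x → eval g (x + 1#) ≈ eval g x + eval (falling k) x * eval p x)
  antidifference-falling N k [] _ =
    [] , ≈-refl , λ x → ≈-sym (≈-trans (+-identityˡ _) (zeroʳ _))
  antidifference-falling (suc N) k (a ∷ p) (s≤s l)
    with antidifference-falling N (suc k) (quotient (fromℕ k) p)
           (subst (ℕ._≤ N) (≡.sym (length-quotient (fromℕ k) p)) l)
       | fromℕ-inverse k
  ... | g , g0 , step | y , e = (r * y) *ₚ falling (suc k) +ₚ g , at-0 , at-+1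
    where
    r = eval (a ∷ p) (fromℕ k)
    h = (r * y) *ₚ falling (suc k) +ₚ g
    eval-h : ∀ x → eval h x ≈ r * y * eval (falling (suc k)) x + eval g x
    eval-h x = ≈-trans (eval-+ ((r * y) *ₚ falling (suc k)) g x)
                       (+-congʳ (eval-* (r * y) (falling (suc k)) x))
    at-0 : eval h 0# ≈ 0#
    at-0 = begin
      eval h 0#                                      ≈⟨ eval-h 0# ⟩
      r * y * eval (falling (suc k)) 0# + eval g 0#  ≈⟨ +-cong (*-congˡ (falling-0 k)) g0 ⟩
      r * y * 0# + 0#                                ≈⟨ +-identityʳ _ ⟩
      r * y * 0#                                     ≈⟨ zeroʳ _ ⟩
      0#                                             ∎
    at-+1 : ∀ x → eval h (x + 1#) ≈ eval h x + eval (falling k) x * eval (a ∷ p) x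
    at-+1 x = begin
      eval h (x + 1#)
        ≈⟨ eval-h (x + 1#) ⟩
      r * y * eval (falling (suc k)) (x + 1#) + eval g (x + 1#)
        ≈⟨ +-cong (*-congˡ (falling-step k x)) (step x) ⟩
      r * y * (F′ + n * F) + (G + F′ * Q)
        ≈⟨ solve 7 (λ r y F′ n F G Q → r :* y :* (F′ :+ n :* F) :+ (G :+ F′ :* Q)
             := r :* y :* F′ :+ G :+ (r :* (y :* n) :* F :+ F′ :* Q)) ≈-refl r y F′ n F G Q ⟩
      r * y * F′ + G + (r * (y * n) * F + F′ * Q)
        ≈⟨ +-cong (≈-sym (eval-h x)) (+-cong (*-congʳ (≈-trans (*-congˡ e) (*-identityʳ r)))
                                             (*-congʳ (eval-falling k x))) ⟩
      eval h x + (r * F + d * F * Q)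
        ≈⟨ +-congˡ (solve 4 (λ r F d Q → r :* F :+ d :* F :* Q := F :* (r :+ d :* Q)) ≈-refl r F d Q) ⟩
      eval h x + F * (r + d * Q)
        ≈⟨ +-congˡ (*-congˡ (+-congˡ (*-congˡ (eval-congʳ q (≈-sym k+d≈x))))) ⟩
      eval h x + F * (r + d * eval q (fromℕ k + d))
        ≈⟨ +-congˡ (*-congˡ (eval-quotient (fromℕ k) d a p)) ⟨
      eval h x + F * eval (a ∷ p) (fromℕ k + d)
        ≈⟨ +-congˡ (*-congˡ (eval-congʳ (a ∷ p) k+d≈x)) ⟩
      eval h x + F * eval (a ∷ p) x ∎
      where
      q  = quotient (fromℕ k) p
      F  = eval (falling k) x
      F′ = eval (falling (suc k)) x
      G  = eval g x
      Q  = eval q x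
      n  = fromℕ (suc k)
      d  = x + - fromℕ k
      k+d≈x : fromℕ k + d ≈ x
      k+d≈x = ≈-trans (+-comm _ _) (x-y+y≈x x (fromℕ k))

  antidifference-exists : ∀ f → ∃ (IsAntidifference f)
  antidifference-exists f with antidifference-falling _ 0 f ℕ.≤-refl
  ... | g , g0 , step = g , g0 , values-determine (Δ g) f λ n _ → let x = fromℕ n in begin
    eval (Δ g) x                                        ≈⟨ eval-Δ g x ⟩
    eval g (x + 1#) + - eval g x                        ≈⟨ +-congʳ (step x) ⟩
    eval g x + (1# + x * 0#) * eval f x + - eval g x    ≈⟨ +-congʳ (+-comm _ _) ⟩
    (1# + x * 0#) * eval f x + eval g x + - eval g x    ≈⟨ x+y-y≈x _ _ ⟩
    (1# + x * 0#) * eval f x                            ≈⟨ *-congʳ (≈-trans (+-congˡ (zeroʳ x)) (+-identityʳ 1#)) ⟩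
    1# * eval f x                                       ≈⟨ *-identityˡ _ ⟩
    eval f x                                            ∎

  antidifference-unique : ∀ f {g h} → IsAntidifference f g → IsAntidifference f h → g ≈ₚ h
  antidifference-unique f {g} {h} (g0 , Δg) (h0 , Δh) = values-determine g h λ n _ → agree n
    where
    agree : ∀ n → eval g (fromℕ n) ≈ eval h (fromℕ n)
    agree zero    = ≈-trans g0 (≈-sym h0)
    agree (suc n) = begin
      eval g (fromℕ (suc n))                   ≈⟨ eval-suc g n ⟩
      eval (Δ g) (fromℕ n) + eval g (fromℕ n)  ≈⟨ +-cong (eval-cong (Δ g) (Δ h) Δg≈Δh ≈-refl) (agree n) ⟩
      eval (Δ h) (fromℕ n) + eval h (fromℕ n)  ≈⟨ eval-suc h n ⟨
      eval h (fromℕ (suc n))                   ∎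
      where
      Δg≈Δh : Δ g ≈ₚ Δ h
      Δg≈Δh i = ≈-trans (Δg i) (≈-sym (Δh i))

  abstract
    antidifference : ∀ f → ∃! _≈ₚ_ (IsAntidifference f)
    antidifference f with antidifference-exists f
    ... | g , is-g = g , is-g , λ {h} is-h → antidifference-unique f {g} {h} is-g is-h

  Δ⁻¹ : Poly → Poly
  Δ⁻¹ f = proj₁ (antidifference f)

  sumOverSubsets-polynomial : ∀ b s → (∀ k → b ℕ.≤ k → s k ≡ 0) →
    ∃ λ p → ∀ n → eval p (fromℕ n) ≈ fromℕ (sumOverSubsets s n)
  sumOverSubsets-polynomial zero s s≡0 =
    [] , λ n → ≈-reflexive (≡.sym (cong fromℕ (sum-map-0 _ (allSubsets n) λ {I} _ → s≡0 ∣ I ∣ z≤n)))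
  sumOverSubsets-polynomial (suc b) s s≡0
    with sumOverSubsets-polynomial b (s ∘ suc) (λ k b≤k → s≡0 (suc k) (s≤s b≤k))
  ... | q , q-values with antidifference-exists q
  ...   | g , g0 , Δg = (fromℕ (s 0) ∷ []) +ₚ g , values
    where
    p = (fromℕ (s 0) ∷ []) +ₚ g
    eval-p : ∀ x → eval p x ≈ fromℕ (s 0) + eval g x
    eval-p x = ≈-trans (eval-+ (fromℕ (s 0) ∷ []) g x)
                       (+-congʳ (≈-trans (+-congˡ (zeroʳ x)) (+-identityʳ _)))
    values : ∀ n → eval p (fromℕ n) ≈ fromℕ (sumOverSubsets s n)
    values zero = begin
      eval p 0#                ≈⟨ eval-p 0# ⟩
      fromℕ (s 0) + eval g 0#  ≈⟨ +-congˡ g0 ⟩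
      fromℕ (s 0) + 0#         ≈⟨ ·-homo-+ 1# (s 0) 0 ⟨
      fromℕ (s 0 ℕ.+ 0)        ∎
    values (suc n) = begin
      eval p (fromℕ (suc n))                                     ≈⟨ eval-p _ ⟩
      fromℕ (s 0) + eval g (fromℕ (suc n))                       ≈⟨ +-congˡ (eval-suc g n) ⟩
      fromℕ (s 0) + (eval (Δ g) (fromℕ n) + eval g (fromℕ n))    ≈⟨ solve 3 (λ x y z →
        x :+ (y :+ z) := x :+ z :+ y) ≈-refl (fromℕ (s 0)) _ _ ⟩
      fromℕ (s 0) + eval g (fromℕ n) + eval (Δ g) (fromℕ n)
        ≈⟨ +-cong (≈-sym (eval-p _)) (eval-cong (Δ g) q Δg ≈-refl) ⟩
      eval p (fromℕ n) + eval q (fromℕ n)                        ≈⟨ +-cong (values n) (q-values n) ⟩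
      fromℕ (sumOverSubsets s n) + fromℕ (sumOverSubsets (s ∘ suc) n) ≈⟨ ·-homo-+ 1# (sumOverSubsets s n) _ ⟨
      fromℕ (sumOverSubsets s n ℕ.+ sumOverSubsets (s ∘ suc) n)
        ≈⟨ ≈-reflexive (cong fromℕ (sumOverSubsets-suc s n)) ⟨
      fromℕ (sumOverSubsets s (suc n)) ∎

  counting-polynomial : ∀ {m} (P : LabeledPoset m) →
    ∃ λ p → ∀ n → eval p (fromℕ n) ≈ fromℕ (length (ωOrderPreservingMaps P n))
  counting-polynomial {m} P
    with sumOverSubsets-polynomial (suc m) (numSurjections P) (numSurjections-vanishes P)
  ... | p , values = p , λ n →
    ≈-trans (values n) (≈-reflexive (cong fromℕ (≡.sym (length-ωOrderPreservingMaps P n))))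

  abstract
    orderPolynomial : ∀ {m} (P : LabeledPoset m) → ∃! _≈ₚ_ (IsOrderPolynomial P)
    orderPolynomial P with counting-polynomial P
    ... | p , values = p , (λ n _ → values n) , λ {q} q-values →
      values-determine p q λ n 1≤n → ≈-trans (values n) (≈-sym (q-values n 1≤n))

  Ω : ∀ {m} → LabeledPoset m → Poly
  Ω P = proj₁ (orderPolynomial P)

{-# OPTIONS --safe #-}
-- Classify the ω-order-preserving maps f : P → [n+1] by S = f⁻¹(1).  Being
-- the fibre over the minimum, S is an ideal, and it is ω-natural because f
-- is constant on it; f is then determined by S and by f - 1 on P ∖ S,
-- which may be any ω-order-preserving map to [n].  The maps with S = ∅
-- are counted by Ω(P; n), so the remaining ones give the difference
-- Ω(P; n+1) - Ω(P; n).  Moreover Ω(P; 0) = 0, since the polynomial counts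
-- maps at 0 as well and there is no map from a nonempty set to [0].

module Submission where

open import Defs
open import Algebra.Apartness.Bundles using (HeytingField)
open import Algebra.Bundles using (CommutativeRing)
import Algebra.Properties.Group as GroupProperties
import Algebra.Properties.Semiring.Mult as Multiples
open import Data.Empty using (⊥-elim)
open import Data.Fin.Base as Fin using (Fin; zero; suc)
import Data.Fin.Properties as Fin
open import Data.Fin.Subset using (Subset; Side; inside; outside; _∈_; _∉_; Nonempty; ∣_∣; ∁; ⊥)
open import Data.Fin.Subset.Properties
  using (_∈?_; nonempty?; ∉⊥; Empty-unique; x∉p⇒x∈∁p)
open import Data.List.Base using (List; []; _∷_; map; filter; length)
import Data.List.Properties as List
open import Data.List.Membership.Propositional using () renaming (_∈_ to _∈ₗ_)
open import Data.List.Membership.Propositional.Properties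
  using (∈-filter⁺; ∈-filter⁻; ∈-map⁺; ∈-map⁻)
open import Data.List.Relation.Unary.All as All using ()
open import Data.List.Relation.Unary.AllPairs using (_∷_)
open import Data.List.Relation.Unary.Any using (here; there)
open import Data.List.Relation.Unary.Unique.Propositional using (Unique)
import Data.List.Relation.Unary.Unique.Propositional.Properties as Unique
open import Data.Nat.Base using (ℕ; zero; suc; _≤_; _<_; _+_; z≤n; s≤s)
open import Data.Nat.ListAction using (sum)
import Data.Nat.Properties as ℕ
open import Data.Product using (∃; _×_; _,_; proj₁; proj₂)
open import Data.Vec.Base as Vec using (Vec; []; _∷_; lookup; replicate)
import Data.Vec.Properties as Vec
open import Function.Base using (_∘_)
open import Function.Definitions using (Injective)
import Relation.Binary.Reasoning.Setoid as ≈-Reasoning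
open import Relation.Binary.PropositionalEquality
  using (_≡_; _≢_; refl; sym; trans; cong; cong₂; subst; subst₂)
open import Relation.Nullary using (¬_; yes; no)
open import Relation.Nullary.Decidable using (_×-dec_)
open import Relation.Unary using (Decidable)

-- Sums and enumerations of lists.

sum-map-filter : ∀ {a q} {A : Set a} {Q : A → Set q} (Q? : Decidable Q) {f g : A → ℕ} xs →
                 (∀ {x} → x ∈ₗ xs → Q x → f x ≡ g x) →
                 (∀ {x} → x ∈ₗ xs → ¬ Q x → f x ≡ 0) →
                 sum (map f xs) ≡ sum (map g (filter Q? xs))
sum-map-filter Q? []       f≡g f≡0 = refl
sum-map-filter Q? (x ∷ xs) f≡g f≡0 with Q? x
... | yes qx = cong₂ _+_ (f≡g (here refl) qx) (sum-map-filter Q? xs (f≡g ∘ there) (f≡0 ∘ there))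
... | no ¬qx = cong₂ _+_ (f≡0 (here refl) ¬qx) (sum-map-filter Q? xs (f≡g ∘ there) (f≡0 ∘ there))

∉⇒length≡0 : ∀ {a} {A : Set a} (xs : List A) → (∀ {x} → ¬ x ∈ₗ xs) → length xs ≡ 0
∉⇒length≡0 []       ∉ = refl
∉⇒length≡0 (x ∷ xs) ∉ = ⊥-elim (∉ (here refl))

-- Since the first choice is made at every position, the enumeration of subsets begins with the
-- empty set. This lets the summand for `⊥` be split off as the head of the list.
allVecs-head : ∀ {a} {A : Set a} (x : A) xs m → ∃ λ vs → allVecs (x ∷ xs) m ≡ replicate m x ∷ vs
allVecs-head x xs zero    = [] , refl
allVecs-head x xs (suc m) with allVecs (x ∷ xs) m | allVecs-head x xs m
... | _ | vs , refl = _ , refl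

-- Zero sets of maps and extension by zero.

isZero : ∀ {n} → Fin (suc n) → Side
isZero zero    = inside
isZero (suc _) = outside

isZero⇒≡0 : ∀ {n} (i : Fin (suc n)) → isZero i ≡ inside → i ≡ zero
isZero⇒≡0 zero _ = refl

-- The least value 1 of [n+1] is `zero` in `Fin (suc n)`, so this is the fibre f⁻¹(1).
zeroSet : ∀ {m n} → Vec (Fin (suc n)) m → Subset m
zeroSet = Vec.map isZero

∈-zeroSet⁻ : ∀ {m n} (v : Vec (Fin (suc n)) m) {x} → x ∈ zeroSet v → lookup v x ≡ zero
∈-zeroSet⁻ v {x} x∈ =
  isZero⇒≡0 _ (trans (sym (Vec.lookup-map x isZero v)) (Vec.[]=⇒lookup x∈))

∈-zeroSet⁺ : ∀ {m n} (v : Vec (Fin (suc n)) m) {x} → lookup v x ≡ zero → x ∈ zeroSet v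
∈-zeroSet⁺ v {x} e =
  Vec.lookup⇒[]= x (zeroSet v) (trans (Vec.lookup-map x isZero v) (cong isZero e))

zeroSet-map-suc : ∀ {m n} (v : Vec (Fin n) m) → zeroSet (Vec.map suc v) ≡ ⊥
zeroSet-map-suc []      = refl
zeroSet-map-suc (_ ∷ v) = cong (outside ∷_) (zeroSet-map-suc v)

zeroSet≡⊥⇒map-suc : ∀ {m n} (w : Vec (Fin (suc n)) m) → zeroSet w ≡ ⊥ → ∃ λ v → Vec.map suc v ≡ w
zeroSet≡⊥⇒map-suc []          _ = [] , refl
zeroSet≡⊥⇒map-suc (suc i ∷ w) e with zeroSet≡⊥⇒map-suc w (Vec.∷-injectiveʳ e)
... | v , refl = i ∷ v , refl

-- Recovers f from S and from f - 1 off S. Recursion on `S` follows the computation of `∣ ∁ S ∣`, so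
-- each entry of `v` is consumed at an `outside` position and no transport between index types
-- arises.
extendByZero : ∀ {m n} (S : Subset m) → Vec (Fin n) ∣ ∁ S ∣ → Vec (Fin (suc n)) m
extendByZero []            v       = []
extendByZero (inside ∷ S)  v       = zero ∷ extendByZero S v
extendByZero (outside ∷ S) (i ∷ v) = suc i ∷ extendByZero S v

zeroSet-extendByZero : ∀ {m n} (S : Subset m) (v : Vec (Fin n) ∣ ∁ S ∣) →
                       zeroSet (extendByZero S v) ≡ S
zeroSet-extendByZero []            v       = refl
zeroSet-extendByZero (inside ∷ S)  v       = cong (inside ∷_) (zeroSet-extendByZero S v)
zeroSet-extendByZero (outside ∷ S) (_ ∷ v) = cong (outside ∷_) (zeroSet-extendByZero S v)

extendByZero-injective : ∀ {m n} (S : Subset m) → Injective _≡_ _≡_ (extendByZero {n = n} S)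
extendByZero-injective [] {[]} {[]} e = refl
extendByZero-injective (inside ∷ S) e = extendByZero-injective S (Vec.∷-injectiveʳ e)
extendByZero-injective (outside ∷ S) {_ ∷ _} {_ ∷ _} e =
  cong₂ _∷_ (Fin.suc-injective (Vec.∷-injectiveˡ e)) (extendByZero-injective S (Vec.∷-injectiveʳ e))

extendByZero-surjective : ∀ {m n} {S : Subset m} (w : Vec (Fin (suc n)) m) → zeroSet w ≡ S →
                          ∃ λ v → extendByZero S v ≡ w
extendByZero-surjective []          refl = [] , refl
extendByZero-surjective (zero ∷ w)  refl with extendByZero-surjective w refl
... | v , e = v , cong (zero ∷_) e
extendByZero-surjective (suc i ∷ w) refl with extendByZero-surjective w refl
... | v , e = i ∷ v , cong (suc i ∷_) e

lookup-extendByZero-∈ : ∀ {m n} (S : Subset m) (v : Vec (Fin n) ∣ ∁ S ∣) {x} → x ∈ S →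
                        lookup (extendByZero S v) x ≡ zero
lookup-extendByZero-∈ S v {x} x∈S =
  ∈-zeroSet⁻ (extendByZero S v) (subst (x ∈_) (sym (zeroSet-extendByZero S v)) x∈S)

-- `embed (∁ S)` skips exactly the positions at which `extendByZero S` inserts a zero.
lookup-extendByZero-embed : ∀ {m n} (S : Subset m) (v : Vec (Fin n) ∣ ∁ S ∣) i →
                            lookup (extendByZero S v) (embed (∁ S) i) ≡ suc (lookup v i)
lookup-extendByZero-embed (inside ∷ S)  v       i       = lookup-extendByZero-embed S v i
lookup-extendByZero-embed (outside ∷ S) (_ ∷ v) zero    = refl
lookup-extendByZero-embed (outside ∷ S) (_ ∷ v) (suc i) = lookup-extendByZero-embed S v i

-- The list of ω-order-preserving maps, for `P` and `P ∖ S` alike.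

module _ {m} (P : LabeledPoset m) where

  ∈-ωOrderPreservingMaps⁺ : ∀ {n} {v : Vec (Fin n) m} → IsωOrderPreserving P (lookup v) →
                            v ∈ₗ ωOrderPreservingMaps P n
  ∈-ωOrderPreservingMaps⁺ op = ∈-filter⁺ _ (∈-allMaps _) op

  ∈-ωOrderPreservingMaps⁻ : ∀ {n} {v : Vec (Fin n) m} → v ∈ₗ ωOrderPreservingMaps P n →
                            IsωOrderPreserving P (lookup v)
  ∈-ωOrderPreservingMaps⁻ {n} v∈ = proj₂ (∈-filter⁻ _ {xs = allMaps m n} v∈)

  ωOrderPreservingMaps-unique : ∀ n → Unique (ωOrderPreservingMaps P n)
  ωOrderPreservingMaps-unique n = Unique.filter⁺ _ (allMaps-unique m n)

-- Order preservation in terms of the zero set and the remaining values.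

module _ {m} (P : LabeledPoset m) where

  open LabeledPoset P using (_≼_; _≺_; ω; isIdeal?; isNatural?)

  zeroSet-ideal : ∀ {n} (v : Vec (Fin (suc n)) m) → IsωOrderPreserving P (lookup v) →
                  IsIdeal P (zeroSet v)
  zeroSet-ideal v (mono , _) x y y∈ x≼y = ∈-zeroSet⁺ v
    (Fin.toℕ-injective (ℕ.n≤0⇒n≡0 (subst (lookup v x Fin.≤_) (∈-zeroSet⁻ v y∈) (mono x y x≼y))))

  -- A label inversion between x ≼ y would force a strict increase from x to y, but both values are
  -- zero. The two elements are distinct because their labels are.
  zeroSet-natural : ∀ {n} (v : Vec (Fin (suc n)) m) → IsωOrderPreserving P (lookup v) →
                    IsNatural P (zeroSet v)
  zeroSet-natural v (_ , strict) x y x∈ y∈ x≼y = ℕ.≮⇒≥ λ ωy<ωx →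
    Fin.<-irrefl (trans (∈-zeroSet⁻ v x∈) (sym (∈-zeroSet⁻ v y∈)))
      (strict y x (x≼y , λ { refl → ℕ.<-irrefl refl ωy<ωx }) ωy<ωx)

  preserving-map-suc⁺ : ∀ {n} (v : Vec (Fin n) m) → IsωOrderPreserving P (lookup v) →
                        IsωOrderPreserving P (lookup (Vec.map suc v))
  preserving-map-suc⁺ v (mono , strict)
    = (λ x y x≼y → subst₂ Fin._≤_ (sym (Vec.lookup-map x suc v)) (sym (Vec.lookup-map y suc v))
                     (s≤s (mono x y x≼y)))
    , (λ x y y≺x l → subst₂ Fin._<_ (sym (Vec.lookup-map y suc v)) (sym (Vec.lookup-map x suc v))
                       (s≤s (strict x y y≺x l)))

  preserving-map-suc⁻ : ∀ {n} (v : Vec (Fin n) m) →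
                        IsωOrderPreserving P (lookup (Vec.map suc v)) →
                        IsωOrderPreserving P (lookup v)
  preserving-map-suc⁻ v (mono , strict)
    = (λ x y x≼y → ℕ.≤-pred
         (subst₂ Fin._≤_ (Vec.lookup-map x suc v) (Vec.lookup-map y suc v) (mono x y x≼y)))
    , (λ x y y≺x l → ℕ.≤-pred
         (subst₂ Fin._<_ (Vec.lookup-map y suc v) (Vec.lookup-map x suc v) (strict x y y≺x l)))

  preserving-extendByZero⁺ : ∀ {n} (S : Subset m) → IsIdeal P S → IsNatural P S →
                             (v : Vec (Fin n) ∣ ∁ S ∣) → IsωOrderPreserving (P ∖ S) (lookup v) →
                             IsωOrderPreserving P (lookup (extendByZero S v))
  preserving-extendByZero⁺ S ideal natural v (mono , strict) = mono′ , strict′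
    where
    w = extendByZero S v
    outside-S : ∀ {x} → x ∉ S → ∃ λ i → embed (∁ S) i ≡ x
    outside-S x∉S = embed-surjective (∁ S) (x∉p⇒x∈∁p x∉S)
    mono′ : ∀ x y → x ≼ y → lookup w x Fin.≤ lookup w y
    mono′ x y x≼y with x ∈? S
    ... | yes x∈S rewrite lookup-extendByZero-∈ S v x∈S = z≤n
    -- An ideal containing `y` would contain `x`, so `y` is outside `S` too and both values are
    -- successors.
    ... | no  x∉S with outside-S x∉S | outside-S (λ y∈S → x∉S (ideal x y y∈S x≼y))
    ...   | i , refl | j , refl
            rewrite lookup-extendByZero-embed S v i | lookup-extendByZero-embed S v j
            = s≤s (mono i j x≼y)
    strict′ : ∀ x y → y ≺ x → ω x < ω y → lookup w y Fin.< lookup w x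
    strict′ x y (y≼x , y≢x) l with x ∈? S
    -- The ideal `S` contains `y` together with `x`, and naturality then excludes the inversion `l`.
    -- So no strict inequality is ever demanded between two zeros.
    ... | yes x∈S = ⊥-elim (ℕ.<⇒≱ l (natural y x (ideal y x x∈S y≼x) x∈S y≼x))
    ... | no  x∉S with outside-S x∉S | y ∈? S
    ...   | i , refl | yes y∈S
            rewrite lookup-extendByZero-embed S v i | lookup-extendByZero-∈ S v y∈S = s≤s z≤n
    ...   | i , refl | no y∉S with outside-S y∉S
    ...     | j , refl
              rewrite lookup-extendByZero-embed S v i | lookup-extendByZero-embed S v j
              = s≤s (strict i j (y≼x , y≢x ∘ cong (embed (∁ S))) l)

  preserving-extendByZero⁻ : ∀ {n} (S : Subset m) (v : Vec (Fin n) ∣ ∁ S ∣) →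
                             IsωOrderPreserving P (lookup (extendByZero S v)) →
                             IsωOrderPreserving (P ∖ S) (lookup v)
  preserving-extendByZero⁻ S v (mono , strict)
    = (λ i j i≼j → ℕ.≤-pred (subst₂ Fin._≤_ (lookup-extendByZero-embed S v i)
         (lookup-extendByZero-embed S v j) (mono _ _ i≼j)))
    , (λ { i j (j≼i , j≢i) l → ℕ.≤-pred (subst₂ Fin._<_ (lookup-extendByZero-embed S v j)
         (lookup-extendByZero-embed S v i)
         (strict _ _ (j≼i , j≢i ∘ embed-injective (∁ S)) l)) })

  -- Counting the maps to [n+1] by zero set.

  module _ (n : ℕ) where

    mapsWithZeroSet : Subset m → List (Vec (Fin (suc n)) m)
    mapsWithZeroSet = fibre _≟ₛ_ zeroSet (ωOrderPreservingMaps P (suc n))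

    ∈-mapsWithZeroSet⁺ : ∀ {S w} → IsωOrderPreserving P (lookup w) → zeroSet w ≡ S →
                         w ∈ₗ mapsWithZeroSet S
    ∈-mapsWithZeroSet⁺ op e = ∈-filter⁺ _ (∈-ωOrderPreservingMaps⁺ P op) e

    ∈-mapsWithZeroSet⁻ : ∀ {S w} → w ∈ₗ mapsWithZeroSet S →
                         IsωOrderPreserving P (lookup w) × zeroSet w ≡ S
    ∈-mapsWithZeroSet⁻ w∈ with ∈-filter⁻ _ {xs = ωOrderPreservingMaps P (suc n)} w∈
    ... | w∈′ , e = ∈-ωOrderPreservingMaps⁻ P w∈′ , e

    mapsWithZeroSet-unique : ∀ S → Unique (mapsWithZeroSet S)
    mapsWithZeroSet-unique S = Unique.filter⁺ _ (ωOrderPreservingMaps-unique P (suc n))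

    -- The empty zero set is handled apart from the others: `P ∖ ⊥` lives on `Fin ∣ ∁ ⊥ ∣` rather
    -- than on `Fin m`, so the bijection f ↦ f - 1 is taken directly to maps on `P`.
    length-mapsWithZeroSet-⊥ : length (mapsWithZeroSet ⊥) ≡ length (ωOrderPreservingMaps P n)
    length-mapsWithZeroSet-⊥ = trans
      (unique⇒length-≡ (mapsWithZeroSet-unique ⊥)
        (Unique.map⁺ (map-injective Fin.suc-injective) (ωOrderPreservingMaps-unique P n)) fwd bwd)
      (List.length-map (Vec.map suc) (ωOrderPreservingMaps P n))
      where
      fwd : ∀ {w} → w ∈ₗ mapsWithZeroSet ⊥ → w ∈ₗ map (Vec.map suc) (ωOrderPreservingMaps P n)
      fwd {w} w∈ with ∈-mapsWithZeroSet⁻ w∈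
      ... | op , e with zeroSet≡⊥⇒map-suc w e
      ...   | v , refl = ∈-map⁺ _ (∈-ωOrderPreservingMaps⁺ P (preserving-map-suc⁻ v op))
      bwd : ∀ {w} → w ∈ₗ map (Vec.map suc) (ωOrderPreservingMaps P n) → w ∈ₗ mapsWithZeroSet ⊥
      bwd w∈ with ∈-map⁻ (Vec.map suc) w∈
      ... | v , v∈ , refl = ∈-mapsWithZeroSet⁺
        (preserving-map-suc⁺ v (∈-ωOrderPreservingMaps⁻ P v∈)) (zeroSet-map-suc v)

  -- `extendByZero S` is a bijection onto the fibre; both lists are free of repetitions, so having
  -- the same members gives them the same length.
  length-mapsWithZeroSet : ∀ n S → IsIdeal P S → IsNatural P S →
    length (mapsWithZeroSet n S) ≡ length (ωOrderPreservingMaps (P ∖ S) n)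
  length-mapsWithZeroSet n S ideal natural = trans
    (unique⇒length-≡ (mapsWithZeroSet-unique n S)
      (Unique.map⁺ (extendByZero-injective S) (ωOrderPreservingMaps-unique (P ∖ S) n)) fwd bwd)
    (List.length-map (extendByZero S) (ωOrderPreservingMaps (P ∖ S) n))
    where
    fwd : ∀ {w} → w ∈ₗ mapsWithZeroSet n S →
          w ∈ₗ map (extendByZero S) (ωOrderPreservingMaps (P ∖ S) n)
    fwd {w} w∈ with ∈-mapsWithZeroSet⁻ n w∈
    ... | op , e with extendByZero-surjective w e
    ...   | v , refl =
      ∈-map⁺ _ (∈-ωOrderPreservingMaps⁺ (P ∖ S) (preserving-extendByZero⁻ S v op))
    bwd : ∀ {w} → w ∈ₗ map (extendByZero S) (ωOrderPreservingMaps (P ∖ S) n) →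
          w ∈ₗ mapsWithZeroSet n S
    bwd w∈ with ∈-map⁻ (extendByZero S) w∈
    ... | v , v∈ , refl = ∈-mapsWithZeroSet⁺ n
      (preserving-extendByZero⁺ S ideal natural v (∈-ωOrderPreservingMaps⁻ (P ∖ S) v∈))
      (zeroSet-extendByZero S v)

  -- A member of the fibre would have `S` as its zero set, making `S` a natural ideal, and a
  -- nonempty one since it is not `⊥`.
  length-mapsWithZeroSet-≡0 : ∀ n S → S ≢ ⊥ → ¬ (Nonempty S × IsIdeal P S × IsNatural P S) →
                              length (mapsWithZeroSet n S) ≡ 0
  length-mapsWithZeroSet-≡0 n S S≢⊥ ¬q = ∉⇒length≡0 (mapsWithZeroSet n S) absent
    where
    absent : ∀ {w} → ¬ w ∈ₗ mapsWithZeroSet n S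
    absent {w} w∈ with ∈-mapsWithZeroSet⁻ n w∈
    ... | op , refl = S≢⊥ (Empty-unique λ S≠∅ →
      ¬q (S≠∅ , zeroSet-ideal w op , zeroSet-natural w op))

  -- The counting form of the difference equation, written additively to avoid subtraction in ℕ.
  length-ωOrderPreservingMaps-suc : ∀ n →
    length (ωOrderPreservingMaps P (suc n)) ≡
    length (ωOrderPreservingMaps P n) +
    sum (map (λ S → length (ωOrderPreservingMaps (P ∖ S) n)) (nonemptyNaturalIdeals P))
  length-ωOrderPreservingMaps-suc n = trans
    (length-fibres _≟ₛ_ zeroSet (allSubsets-unique m) ∈-allSubsets (ωOrderPreservingMaps P (suc n)))
    (split (allVecs-head outside (inside ∷ []) m) (allSubsets-unique m))
    where
    f g : Subset m → ℕ
    f S = length (mapsWithZeroSet n S)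
    g S = length (ωOrderPreservingMaps (P ∖ S) n)
    Q? : Decidable (λ S → Nonempty S × IsIdeal P S × IsNatural P S)
    Q? S = nonempty? S ×-dec (isIdeal? S ×-dec isNatural? S)
    -- With the list of subsets generalized to `Ss`, matching on `refl` exposes `⊥` at its head, and
    -- uniqueness keeps `⊥` out of the tail, where all remaining summands are treated.
    split : ∀ {Ss} → (∃ λ Ts → Ss ≡ ⊥ ∷ Ts) → Unique Ss →
            sum (map f Ss) ≡ length (ωOrderPreservingMaps P n) + sum (map g (filter Q? Ss))
    split (Ts , refl) (⊥∉ ∷ _) = cong₂ _+_ (length-mapsWithZeroSet-⊥ n) (trans
      (sum-map-filter Q? Ts
        (λ { _ (_ , ideal , natural) → length-mapsWithZeroSet n _ ideal natural })
        (λ T∈ ¬q → length-mapsWithZeroSet-≡0 n _ (All.lookup ⊥∉ T∈ ∘ sym) ¬q))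
      -- The filter rejects `⊥` as empty, so filtering the tail gives the same list as filtering
      -- everything.
      (cong (sum ∘ map g) (sym (List.filter-reject Q? λ { ((_ , x∈⊥) , _) → ∉⊥ x∈⊥ }))))

-- From counts to polynomials.

module _ {c ℓ₁ ℓ₂} (K : HeytingField c ℓ₁ ℓ₂) (char0 : CharacteristicZero K) where

  open Polynomials K char0
  open CommutativeRing (fieldRing K) using (_≈_; 0#; setoid; semiring; +-group; +-comm; +-cong)
    renaming (refl to ≈-refl; sym to ≈-sym; trans to ≈-trans; reflexive to ≈-reflexive;
              _+_ to _⊕_)
  open GroupProperties +-group using () renaming (∙-cancelʳ to +-cancelʳ)
  open Multiples semiring using () renaming (×-homo-+ to ·-homo-+)
  open ≈-Reasoning setoid

  -- `IsOrderPolynomial` speaks only of n ≥ 1. The polynomial `p` of `counting-polynomial` has the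
  -- right values at 0 as well, and uniqueness identifies `Ω P` with it.
  eval-Ω : ∀ {m} (P : LabeledPoset m) n →
           eval (Ω P) (fromℕ n) ≈ fromℕ (length (ωOrderPreservingMaps P n))
  eval-Ω P n with counting-polynomial P
  ... | p , values = ≈-trans
    (eval-cong (Ω P) p (proj₂ (proj₂ (orderPolynomial P)) {p} λ k _ → values k) ≈-refl) (values n)

  eval-sum-Ω : ∀ {a} {A : Set a} {k : A → ℕ} (Q : ∀ x → LabeledPoset (k x)) xs n →
               eval (sumₚ (map (λ x → Ω (Q x)) xs)) (fromℕ n) ≈
               fromℕ (sum (map (λ x → length (ωOrderPreservingMaps (Q x) n)) xs))
  eval-sum-Ω Q []       n = ≈-refl
  eval-sum-Ω Q (x ∷ xs) n = begin
    eval (Ω (Q x) +ₚ R) (fromℕ n)                    ≈⟨ eval-+ (Ω (Q x)) R _ ⟩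
    eval (Ω (Q x)) (fromℕ n) ⊕ eval R (fromℕ n)      ≈⟨ +-cong (eval-Ω (Q x) n) (eval-sum-Ω Q xs n) ⟩
    fromℕ (count x) ⊕ fromℕ (sum (map count xs))     ≈⟨ ·-homo-+ _ (count x) _ ⟨
    fromℕ (count x + sum (map count xs))             ∎
    where
    R = sumₚ (map (λ y → Ω (Q y)) xs)
    count = λ y → length (ωOrderPreservingMaps (Q y) n)

  -- With a first element to map, the enumeration of maps to `Fin 0` reduces to the empty list, so
  -- the count is 0 by computation. The empty poset would have one map.
  Ω-at-0 : ∀ {m} (P : LabeledPoset m) → 1 ≤ m → eval (Ω P) 0# ≈ 0#
  Ω-at-0 {suc m} P _ = eval-Ω P 0

  -- Values at positive integers determine a polynomial. At each n, adding Ω(P; n) to both sides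
  -- turns the claim into the recursion for the counts.
  ΔΩ : ∀ {m} (P : LabeledPoset m) →
       Δ (Ω P) ≈ₚ sumₚ (map (λ S → Ω (P ∖ S)) (nonemptyNaturalIdeals P))
  ΔΩ P = values-determine (Δ (Ω P)) R λ n _ →
    let x = fromℕ n
        L = length (ωOrderPreservingMaps P n)
        N = sum (map (λ S → length (ωOrderPreservingMaps (P ∖ S) n)) (nonemptyNaturalIdeals P))
    in +-cancelʳ (eval (Ω P) x) (eval (Δ (Ω P)) x) (eval R x) (begin
    eval (Δ (Ω P)) x ⊕ eval (Ω P) x     ≈⟨ eval-suc (Ω P) n ⟨
    eval (Ω P) (fromℕ (suc n))          ≈⟨ eval-Ω P (suc n) ⟩
    fromℕ (length (ωOrderPreservingMaps P (suc n)))
      ≈⟨ ≈-reflexive (cong fromℕ (length-ωOrderPreservingMaps-suc P n)) ⟩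
    fromℕ (L + N)                       ≈⟨ ·-homo-+ _ L N ⟩
    fromℕ L ⊕ fromℕ N                   ≈⟨ +-comm _ _ ⟩
    fromℕ N ⊕ fromℕ L                   ≈⟨ +-cong (eval-sum-Ω (P ∖_) (nonemptyNaturalIdeals P) n)
                                                  (eval-Ω P n) ⟨
    eval R x ⊕ eval (Ω P) x             ∎)
    where R = sumₚ (map (λ S → Ω (P ∖ S)) (nonemptyNaturalIdeals P))

theorem2p7 : ∀ {c ℓ₁ ℓ₂} (K : HeytingField c ℓ₁ ℓ₂) (char0 : CharacteristicZero K) →
    let open Polynomials K char0 in
    ∀ {m : ℕ} (P : LabeledPoset m) → 2 ≤ m →
    Ω P ≈ₚ Δ⁻¹ (sumₚ (map (λ S → Ω (P ∖ S)) (nonemptyNaturalIdeals P)))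
theorem2p7 K char0 P 2≤m =
  -- Both sides are antidifferences of `f` normalized at 0, `Δ⁻¹ f` by its construction.
  antidifference-unique f {Ω P} {Δ⁻¹ f}
    (Ω-at-0 K char0 P (ℕ.<⇒≤ 2≤m) , ΔΩ K char0 P)
    (proj₁ (proj₂ (antidifference f)))
  where
  open Polynomials K char0
  f = sumₚ (map (λ S → Ω (P ∖ S)) (nonemptyNaturalIdeals P))
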